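{- Let $k\geq 0$ be an integer. Every graph $G$ with feedback vertex number at most $k$ and girth at least $7$ is $2$-colourable with clustering $\binom{k}{2}+k+1$.
   Context: Graphs are finite, simple and undirected. The feedback vertex number of a graph $G$ is the minimum size of a set $A\subseteq V(G)$ such that $G-A$ is a forest. The girth of a graph is the length of its shortest cycle (infinite for a forest). A $2$-colouring assigns one of at most two colours to each vertex (not necessarily properly). A monochromatic component is a connected component of the subgraph induced by all vertices of a single colour. A colouring has clustering $c$ if every monochromatic component has at most $c$ vertices. -}

module Defs where

open import Data.Empty using (⊥)
open import Data.Fin.Base using (Fin; zero; suc)
open import Data.Fin.Properties using (_≟_; any?; injective⇒≤)
open import Data.Fin.Subset using (Subset; _∈_; _⊆_; _∩_; ∁; ∣_∣)
open import Data.Fin.Subset.Properties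
  using (_∈?_; _⊆?_; anySubset?; x∈p∩q⁺; x∈p⇒x∉∁p)
open import Data.List.Base using (List; []; _∷_; _∷ʳ_; length; lookup)
open import Data.List.Membership.Propositional.Properties using (∈-lookup)
open import Data.List.Relation.Unary.All as All using ()
open import Data.List.Relation.Unary.AllPairs using ([]; _∷_; allPairs?)
open import Data.List.Relation.Unary.Linked using (Linked; _∷_; linked?)
open import Data.List.Relation.Unary.Unique.Propositional using (Unique)
open import Data.Nat.Base using (ℕ; zero; suc; _≤_; z≤n; s≤s)
import Data.Nat.Properties as ℕ
open import Data.Product.Base using (∃; _×_; _,_; proj₁; proj₂)
open import Data.Vec.Base using (tabulate)
open import Function.Base using (_∘_; id)
open import Function.Bundles using (_⇔_)
open import Level using (0ℓ)
open import Relation.Binary.Construct.Add.Supremum.NonStrict _≤_ public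
  using (_≤⁺_)
open import Relation.Binary.Construct.Closure.ReflexiveTransitive using (Star)
open import Relation.Binary.Core using (Rel)
import Relation.Binary.Definitions as B
open import Relation.Binary.PropositionalEquality.Core
  using (_≡_; refl; sym; cong)
open import Relation.Nullary.Construct.Add.Supremum public
  using (_⁺; ⊤⁺; [_])
open import Relation.Nullary.Decidable
  using (Dec; yes; no; does; map′; ¬?; _×-dec_)
open import Relation.Nullary.Negation using (¬_; contradiction)
open import Relation.Unary using (Pred; Decidable)

private
  variable
    n : ℕ

-- The vertex set is an arbitrary subset of the labels Fin n, so that an
-- induced subgraph is again a graph over the same labels.

record Graph (n : ℕ) : Set₁ where
  field
    V          : Subset n
    Adj        : Rel (Fin n) 0ℓ
    adj?       : B.Decidable Adj
    adj-sym    : B.Symmetric Adj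
    adj-irrefl : B.Irreflexive _≡_ Adj
    adj⇒∈V     : ∀ {u v} → Adj u v → u ∈ V

open Graph public

infix 9 _⟨_⟩
infixl 8 _─_

_⟨_⟩ : Graph n → Subset n → Graph n
G ⟨ S ⟩ = record
  { V          = V G ∩ S
  ; Adj        = λ u v → Adj G u v × u ∈ S × v ∈ S
  ; adj?       = λ u v → adj? G u v ×-dec u ∈? S ×-dec v ∈? S
  ; adj-sym    = λ (uv , u∈S , v∈S) → adj-sym G uv , v∈S , u∈S
  ; adj-irrefl = λ u≡v (uv , _) → adj-irrefl G u≡v uv
  ; adj⇒∈V     = λ (uv , u∈S , _) → x∈p∩q⁺ (adj⇒∈V G uv , u∈S)
  }

_─_ : Graph n → Subset n → Graph n
G ─ A = G ⟨ ∁ A ⟩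

-- A cycle is listed by its distinct vertices in cyclic order, so its
-- length is the length of the list.

IsCycle : Graph n → Pred (List (Fin n)) 0ℓ
IsCycle G []       = ⊥
IsCycle G (v ∷ vs) =
  3 ≤ length (v ∷ vs) × Unique (v ∷ vs) × Linked (Adj G) (v ∷ vs ∷ʳ v)

HasCycleOfLength : Graph n → Pred ℕ 0ℓ
HasCycleOfLength G l = ∃ λ vs → length vs ≡ l × IsCycle G vs

IsForest : Graph n → Set
IsForest G = ∀ vs → ¬ IsCycle G vs

isCycle? : (G : Graph n) → Decidable (IsCycle G)
isCycle? G []       = no id
isCycle? G (v ∷ vs) =
  (3 ℕ.≤? length (v ∷ vs))
    ×-dec allPairs? (λ x y → ¬? (x ≟ y)) (v ∷ vs)
    ×-dec linked? (adj? G) (v ∷ vs ∷ʳ v)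

private
  anyList? : {P : Pred (List (Fin n)) 0ℓ} → Decidable P →
             ∀ l → Dec (∃ λ xs → length xs ≡ l × P xs)
  anyList? P? zero    = map′ (λ p → [] , refl , p) (λ { ([] , _ , p) → p }) (P? [])
  anyList? P? (suc l) = map′
    (λ { (x , xs , eq , p) → x ∷ xs , cong suc eq , p })
    (λ { (x ∷ xs , refl , p) → x , xs , refl , p })
    (any? (λ x → anyList? (P? ∘ (x ∷_)) l))

  lookup-injective : {xs : List (Fin n)} → Unique xs →
                     ∀ {i j} → lookup xs i ≡ lookup xs j → i ≡ j
  lookup-injective (_  ∷ _) {zero}  {zero}  _  = refl
  lookup-injective (x≢ ∷ _) {zero}  {suc j} eq =
    contradiction eq (All.lookup x≢ (∈-lookup j))
  lookup-injective (x≢ ∷ _) {suc i} {zero}  eq =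
    contradiction (sym eq) (All.lookup x≢ (∈-lookup i))
  lookup-injective (_  ∷ u) {suc i} {suc j} eq = cong suc (lookup-injective u eq)

  least : {P : Pred ℕ 0ℓ} → Decidable P → ∀ i → P i →
          ∃ λ m → P m × (∀ l → P l → m ≤ l)
  least P? zero    p = zero , p , λ _ _ → z≤n
  least P? (suc i) p with P? zero
  ... | yes p₀ = zero , p₀ , λ _ _ → z≤n
  ... | no ¬p₀ with least (P? ∘ suc) i p
  ...   | m , pₘ , min = suc m , pₘ , λ
          { zero    p₀ → contradiction p₀ ¬p₀
          ; (suc l) pₗ → s≤s (min l pₗ)
          }

cycle-length≤n : (G : Graph n) → ∀ vs → IsCycle G vs → length vs ≤ n
cycle-length≤n G (_ ∷ _) (_ , uniq , _) = injective⇒≤ (lookup-injective uniq)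

hasCycleOfLength? : (G : Graph n) → Decidable (HasCycleOfLength G)
hasCycleOfLength? G = anyList? (isCycle? G)

hasCycle? : (G : Graph n) → Dec (∃ (HasCycleOfLength G))
hasCycle? {n} G = map′
  (λ { (l , _ , c) → l , c })
  (λ { (l , vs , refl , c) → l , s≤s (cycle-length≤n G vs c) , vs , refl , c })
  (ℕ.anyUpTo? (hasCycleOfLength? G) (suc n))

isForest? : (G : Graph n) → Dec (IsForest G)
isForest? G = map′
  (λ ¬c vs c → ¬c (length vs , vs , refl , c))
  (λ { f (_ , vs , _ , c) → f vs c })
  (¬? (hasCycle? G))

IsGirth : Graph n → Pred (ℕ ⁺) 0ℓ
IsGirth G [ g ] = HasCycleOfLength G g × (∀ l → HasCycleOfLength G l → g ≤ l)
IsGirth G ⊤⁺    = IsForest G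

∃girth : (G : Graph n) → ∃ (IsGirth G)
∃girth G with hasCycle? G
... | no ¬c = ⊤⁺ , λ vs c → ¬c (length vs , vs , refl , c)
... | yes (l , c) with least (hasCycleOfLength? G) l c
...   | g , isGirth = [ g ] , isGirth

girth : Graph n → ℕ ⁺
girth = proj₁ ∘ ∃girth

girth-isGirth : (G : Graph n) → IsGirth G (girth G)
girth-isGirth = proj₂ ∘ ∃girth

IsFeedbackVertexSet : Graph n → Pred (Subset n) 0ℓ
IsFeedbackVertexSet G A = A ⊆ V G × IsForest (G ─ A)

HasFeedbackVertexSetOfSize : Graph n → Pred ℕ 0ℓ
HasFeedbackVertexSetOfSize G m = ∃ λ A → ∣ A ∣ ≡ m × IsFeedbackVertexSet G A

IsFeedbackVertexNumber : Graph n → Pred ℕ 0ℓ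
IsFeedbackVertexNumber G m =
  HasFeedbackVertexSetOfSize G m ×
  (∀ l → HasFeedbackVertexSetOfSize G l → m ≤ l)

hasFeedbackVertexSetOfSize? :
  (G : Graph n) → Decidable (HasFeedbackVertexSetOfSize G)
hasFeedbackVertexSetOfSize? G m = anySubset? λ A →
  (∣ A ∣ ℕ.≟ m) ×-dec A ⊆? V G ×-dec isForest? (G ─ A)

V-isFeedbackVertexSet : (G : Graph n) → IsFeedbackVertexSet G (V G)
V-isFeedbackVertexSet G = id , λ
  { (_ ∷ [])    (s≤s () , _)
  ; (_ ∷ _ ∷ _) (_ , _ , (uv , u∉V , _) ∷ _) →
      contradiction u∉V (x∈p⇒x∉∁p (adj⇒∈V G uv))
  }

∃feedbackVertexNumber : (G : Graph n) → ∃ (IsFeedbackVertexNumber G)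
∃feedbackVertexNumber G = least (hasFeedbackVertexSetOfSize? G)
  ∣ V G ∣ (V G , refl , V-isFeedbackVertexSet G)

feedbackVertexNumber : Graph n → ℕ
feedbackVertexNumber = proj₁ ∘ ∃feedbackVertexNumber

feedbackVertexNumber-isFeedbackVertexNumber :
  (G : Graph n) → IsFeedbackVertexNumber G (feedbackVertexNumber G)
feedbackVertexNumber-isFeedbackVertexNumber = proj₂ ∘ ∃feedbackVertexNumber

IsComponent : Graph n → Pred (Subset n) 0ℓ
IsComponent G C = ∃ λ v → v ∈ V G × (∀ u → u ∈ C ⇔ Star (Adj G) v u)

-- Labels outside the vertex set also receive a colour, but G ⟨_⟩
-- discards them.

TwoColouring : ℕ → Set
TwoColouring n = Fin n → Fin 2

colourClass : TwoColouring n → Fin 2 → Subset n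
colourClass χ i = tabulate λ v → does (χ v ≟ i)

IsMonochromaticComponent : Graph n → TwoColouring n → Pred (Subset n) 0ℓ
IsMonochromaticComponent G χ C = ∃ λ i → IsComponent (G ⟨ colourClass χ i ⟩) C

HasClustering : Graph n → TwoColouring n → Pred ℕ 0ℓ
HasClustering G χ c = ∀ C → IsMonochromaticComponent G χ C → ∣ C ∣ ≤ c

TwoColourableWithClustering : Graph n → Pred ℕ 0ℓ
TwoColourableWithClustering G c = ∃ λ χ → HasClustering G χ c

{-# OPTIONS --safe #-}
-- Let A be a minimum feedback vertex set, let N be the set of vertices outside
-- A with a neighbour in A, and root every tree of G − A.  Colour A with 0, N
-- with 1, and every other vertex differently from its parent.  Since N
-- separates A from the rest, a monochromatic component is contained in A or
-- is disjoint from A.  In the second case it is a subtree of G − A in which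
-- every vertex u except the top t is in N.  If the parent of u is in N too, the
-- edge to the parent is the middle of a path of length 3 between two vertices
-- of A, and without cycles of length 3, 4 or 6 the edge is determined by this
-- pair.  Otherwise the parent is t, and u is determined by a neighbour in A
-- because there is no 4-cycle.  So the component has at most (k C 2) + k
-- vertices besides t.
module Submission where

open import Defs
open import Data.Bool.Base using (if_then_else_)
open import Data.Fin.Base using (Fin; zero; suc; _↑ˡ_; _↑ʳ_; inject≤; opposite; punchOut; splitAt)
open import Data.Fin.Properties
  using (_≟_; all?; any?; inject≤-injective; punchOut-injective; splitAt-↑ˡ; splitAt-↑ʳ;
    suc-injective; ↑ˡ-injective; ↑ʳ-injective)
open import Data.Fin.Subset using (Subset; inside; outside; _∈_; _∉_; _-_; ⊤; ∁; ∣_∣; Nonempty)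
open import Data.Fin.Subset.Properties
  using (_∈?_; nonempty?; p⊆q⇒∣p∣≤∣q∣; x∈p⇒∣p-x∣<∣p∣; x∈p∧x≢y⇒x∈p-y; x∈∁p⇒x∉p; x∉p⇒x∈∁p;
    ∈⊤; ∣p∣≤n)
open import Data.List.Base using (List; []; _∷_; _∷ʳ_; _++_; length)
import Data.List.Membership.DecPropositional as DecMembership
import Data.List.Membership.Propositional as List
open import Data.List.Membership.Propositional.Properties using (∈-∃++)
open import Data.List.Relation.Unary.All as All using (All; []; _∷_)
open import Data.List.Relation.Unary.All.Properties using (++⁻ˡ; ++⁻ʳ; ¬Any⇒All¬)
open import Data.List.Relation.Unary.AllPairs using ([]; _∷_)
open import Data.List.Relation.Unary.Linked as Linked using (Linked; [-]; _∷_)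
open import Data.List.Relation.Unary.Unique.Propositional using (Unique)
open import Data.Nat.Base using (ℕ; zero; suc; _≤_; _<_; _+_; z≤n; s≤s)
open import Data.Nat.Combinatorics using (_C_; nC1≡n; nCk+nC[k+1]≡[n+1]C[k+1])
open import Data.Nat.Induction using (<-wellFounded)
import Data.Nat.Properties as ℕ
open import Data.Product.Base using (∃; _×_; _,_; proj₁; proj₂)
open import Data.Sum.Base using (_⊎_; inj₁; inj₂)
open import Data.Vec.Base using ([]; _∷_; here; there)
open import Data.Vec.Properties using ([]=⇒lookup; lookup∘tabulate)
open import Function.Base using (_∘_; const)
open import Function.Bundles using (Equivalence)
open import Induction.WellFounded using (Acc; acc)
open import Level using (0ℓ)
open import Relation.Binary.Construct.Closure.ReflexiveTransitive using (Star; ε; _◅_; _◅◅_)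
open import Relation.Binary.Core using (Rel)
import Relation.Binary.Definitions as B
open import Relation.Binary.PropositionalEquality
  using (_≡_; _≢_; refl; sym; trans; cong; cong₂; subst; ≢-sym; module ≡-Reasoning)
open import Relation.Nullary.Decidable
  using (yes; no; does; True; toWitness; _×-dec_; _→-dec_; ¬?; decidable-stable)
open import Relation.Nullary.Negation using (¬_; contradiction)
open import Relation.Unary using (Pred; Decidable)

private
  variable
    n : ℕ

-- Counting

-- Induction on `p`, where `punchOut` deletes the value at the first element from the codomain. The
-- map receives the membership proof because the code of a vertex is computed from a path to it.
injectiveOn⇒∣p∣≤ : ∀ {m} (p : Subset n) (f : ∀ {x} → x ∈ p → Fin m) →
                   (∀ {x y} (x∈p : x ∈ p) (y∈p : y ∈ p) → f x∈p ≡ f y∈p → x ≡ y) →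
                   ∣ p ∣ ≤ m
injectiveOn⇒∣p∣≤ [] f inj = z≤n
injectiveOn⇒∣p∣≤ (outside ∷ p) f inj =
  injectiveOn⇒∣p∣≤ p (f ∘ there) λ x∈p y∈p → suc-injective ∘ inj (there x∈p) (there y∈p)
injectiveOn⇒∣p∣≤ {m = zero} (inside ∷ p) f inj with () ← f here
injectiveOn⇒∣p∣≤ {m = suc m} (inside ∷ p) f inj =
  s≤s (injectiveOn⇒∣p∣≤ p (λ x∈p → punchOut (fresh x∈p)) λ x∈p y∈p eq →
    suc-injective (inj (there x∈p) (there y∈p)
      (punchOut-injective (fresh x∈p) (fresh y∈p) eq)))
  where
  fresh : ∀ {x} (x∈p : x ∈ p) → f here ≢ f (there x∈p)
  fresh x∈p eq with () ← inj here (there x∈p) eq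

index : ∀ {x} {p : Subset n} → x ∈ p → Fin ∣ p ∣
index {p = inside  ∷ p} here        = zero
index {p = inside  ∷ p} (there x∈p) = suc (index x∈p)
index {p = outside ∷ p} (there x∈p) = index x∈p

index-injective : ∀ {x y} {p : Subset n} (x∈p : x ∈ p) (y∈p : y ∈ p) →
                  index x∈p ≡ index y∈p → x ≡ y
index-injective {p = inside  ∷ p} here        here        eq = refl
index-injective {p = inside  ∷ p} (there x∈p) (there y∈p) eq =
  cong suc (index-injective x∈p y∈p (suc-injective eq))
index-injective {p = outside ∷ p} (there x∈p) (there y∈p) eq =
  cong suc (index-injective x∈p y∈p eq)

unique⇒length≤∣p∣ : ∀ {xs} {p : Subset n} → Unique xs → All (_∈ p) xs → length xs ≤ ∣ p ∣
unique⇒length≤∣p∣ []           []           = z≤n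
unique⇒length≤∣p∣ (x≢xs ∷ xs!) (x∈p ∷ xs∈p) = ℕ.≤-trans
  (s≤s (unique⇒length≤∣p∣ xs! (All.zipWith
    (λ (x≢y , y∈p) → x∈p∧x≢y⇒x∈p-y y∈p (≢-sym x≢y)) (x≢xs , xs∈p))))
  (x∈p⇒∣p-x∣<∣p∣ x∈p)

-- The binomial coefficient k choose 2, split into the pairs that contain `zero` and the pairs among
-- the rest, so that `pairIndex` can follow the same recursion.
pairs : ℕ → ℕ
pairs zero    = 0
pairs (suc k) = k + pairs k

pairs≡C2 : ∀ k → pairs k ≡ k C 2
pairs≡C2 zero    = refl
pairs≡C2 (suc k) = begin
  k + pairs k    ≡⟨ cong₂ _+_ (sym (nC1≡n k)) (pairs≡C2 k) ⟩
  k C 1 + k C 2  ≡⟨ nCk+nC[k+1]≡[n+1]C[k+1] k 1 ⟩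
  suc k C 2      ∎
  where open ≡-Reasoning

↑ˡ≢↑ʳ : ∀ {m n} (i : Fin m) (j : Fin n) → i ↑ˡ n ≢ m ↑ʳ j
↑ˡ≢↑ʳ {m} {n} i j eq
  with () ← trans (sym (splitAt-↑ˡ m i n)) (trans (cong (splitAt m) eq) (splitAt-↑ʳ m n j))

-- Both orders of a pair receive the same number: ordered pairs would double the quadratic term of
-- the bound.
pairIndex : ∀ {k} (i j : Fin k) → i ≢ j → Fin (pairs k)
pairIndex         zero    zero    i≢j = contradiction refl i≢j
pairIndex {suc k} zero    (suc j) _   = j ↑ˡ pairs k
pairIndex {suc k} (suc i) zero    _   = i ↑ˡ pairs k
pairIndex {suc k} (suc i) (suc j) i≢j = k ↑ʳ pairIndex i j (i≢j ∘ cong suc)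

pairIndex-injective : ∀ {k} (i j i′ j′ : Fin k) (i≢j : i ≢ j) (i′≢j′ : i′ ≢ j′) →
                      pairIndex i j i≢j ≡ pairIndex i′ j′ i′≢j′ →
                      (i ≡ i′ × j ≡ j′) ⊎ (i ≡ j′ × j ≡ i′)
pairIndex-injective zero zero _ _ i≢j _ _ = contradiction refl i≢j
pairIndex-injective _ _ zero zero _ i≢j _ = contradiction refl i≢j
pairIndex-injective zero (suc j) zero (suc j′) _ _ eq =
  inj₁ (refl , cong suc (↑ˡ-injective _ j j′ eq))
pairIndex-injective zero (suc j) (suc i′) zero _ _ eq =
  inj₂ (refl , cong suc (↑ˡ-injective _ j i′ eq))
pairIndex-injective (suc i) zero zero (suc j′) _ _ eq =
  inj₂ (cong suc (↑ˡ-injective _ i j′ eq) , refl)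
pairIndex-injective (suc i) zero (suc i′) zero _ _ eq =
  inj₁ (cong suc (↑ˡ-injective _ i i′ eq) , refl)
pairIndex-injective zero (suc j) (suc _) (suc _) _ _ eq = contradiction eq (↑ˡ≢↑ʳ j _)
pairIndex-injective (suc i) zero (suc _) (suc _) _ _ eq = contradiction eq (↑ˡ≢↑ʳ i _)
pairIndex-injective (suc _) (suc _) zero (suc j) _ _ eq = contradiction (sym eq) (↑ˡ≢↑ʳ j _)
pairIndex-injective (suc _) (suc _) (suc i) zero _ _ eq = contradiction (sym eq) (↑ˡ≢↑ʳ i _)
pairIndex-injective {suc k} (suc i) (suc j) (suc i′) (suc j′) i≢j i′≢j′ eq
  with pairIndex-injective i j i′ j′ (i≢j ∘ cong suc) (i′≢j′ ∘ cong suc) (↑ʳ-injective k _ _ eq)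
... | inj₁ (refl , refl) = inj₁ (refl , refl)
... | inj₂ (refl , refl) = inj₂ (refl , refl)

-- Rooted forests

adj⇒≢ : ∀ (G : Graph n) {u v} → Adj G u v → u ≢ v
adj⇒≢ G uv u≡v = adj-irrefl G u≡v uv

linked-prefix : ∀ {R : Rel (Fin n) 0ℓ} xs {w zs} → Linked R (xs ++ w ∷ zs) → Linked R (xs ∷ʳ w)
linked-prefix []           _         = [-]
linked-prefix (x ∷ [])     (r ∷ _)   = r ∷ [-]
linked-prefix (x ∷ y ∷ xs) (r ∷ rs)  = r ∷ linked-prefix (y ∷ xs) rs

unique-prefix : ∀ (xs : List (Fin n)) {w zs} → Unique (xs ++ w ∷ zs) → Unique (w ∷ xs)
unique-prefix []       _         = [] ∷ []
unique-prefix (x ∷ xs) (x≢ ∷ u) with unique-prefix xs u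
... | w≢xs ∷ xs! = (≢-sym (All.head (++⁻ʳ xs x≢)) ∷ w≢xs) ∷ ++⁻ˡ xs x≢ ∷ xs!

-- The path is cut at `w` and closed by the edge from `w` to `x`. As `w` lies beyond `y`, at least
-- three vertices remain.
closePath : ∀ (G : Graph n) {w x y} xs → Adj G w x → w List.∈ xs →
            Unique (x ∷ y ∷ xs) → Linked (Adj G) (x ∷ y ∷ xs) → ∃ (IsCycle G)
closePath G {w} {x} {y} xs wx w∈xs u l with ∈-∃++ w∈xs
... | ys , zs , refl =
  w ∷ x ∷ y ∷ ys ,
  s≤s (s≤s (s≤s z≤n)) ,
  unique-prefix (x ∷ y ∷ ys) u ,
  wx ∷ linked-prefix (x ∷ y ∷ ys) l

AtMostOneNeighbourIn : Graph n → Subset n → Pred (Fin n) 0ℓ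
AtMostOneNeighbourIn G S v =
  ∀ x y → x ∈ S → y ∈ S → Adj G v x → Adj G v y → x ≡ y

atMostOneNeighbourIn? : ∀ (G : Graph n) S → Decidable (AtMostOneNeighbourIn G S)
atMostOneNeighbourIn? G S v = all? λ x → all? λ y →
  x ∈? S →-dec (y ∈? S →-dec (adj? G v x →-dec (adj? G v y →-dec x ≟ y)))

module _ (G : Graph n) (forest : IsForest G) (S : Subset n) where

  open DecMembership (_≟_ {n}) using () renaming (_∈?_ to _∈ₗ?_)

  -- The path grows at its head `x`, by a neighbour other than the preceding vertex `y`. In a forest
  -- this neighbour is new, since meeting the path again would close a cycle.
  longPath : (∀ {v} z → v ∈ S → ∃ λ w → w ∈ S × Adj G v w × w ≢ z) → Nonempty S →
             ∀ l → ∃ λ x → ∃ λ y → ∃ λ xs → length xs ≡ l × x ∈ S ×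
             Unique (x ∷ y ∷ xs) × Linked (Adj G) (x ∷ y ∷ xs)
  longPath branch (v , v∈S) zero with branch v v∈S
  ... | w , w∈S , vw , w≢v =
    w , v , [] , refl , w∈S , (w≢v ∷ []) ∷ [] ∷ [] , adj-sym G vw ∷ [-]
  longPath branch S≢∅ (suc l) with longPath branch S≢∅ l
  ... | x , y , xs , refl , x∈S , u , p with branch y x∈S
  ...   | w , w∈S , xw , w≢y with w ∈ₗ? xs
  ...     | yes w∈xs =
    let _ , cycle = closePath G xs (adj-sym G xw) w∈xs u p in contradiction cycle (forest _)
  ...     | no w∉xs  =
    w , x , y ∷ xs , refl , w∈S ,
    (≢-sym (adj⇒≢ G xw) ∷ w≢y ∷ ¬Any⇒All¬ xs w∉xs) ∷ u , adj-sym G xw ∷ p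

  ∃leaf : Nonempty S → ∃ λ v → v ∈ S × AtMostOneNeighbourIn G S v
  ∃leaf S≢∅ with any? (λ v → v ∈? S ×-dec atMostOneNeighbourIn? G S v)
  ... | yes leaf  = leaf
  ... | no ¬leaf =
    -- Together with `x` and `y` the path has `n` + 2 distinct vertices, more than there are labels.
    let x , y , xs , ∣xs∣≡n , _ , u , _ = longPath branch S≢∅ n in
    contradiction
      (ℕ.≤-trans (unique⇒length≤∣p∣ {p = ⊤} u (All.universal (λ _ → ∈⊤) _)) (∣p∣≤n {n} ⊤))
      (ℕ.<⇒≱ (s≤s (ℕ.m≤n⇒m≤1+n (ℕ.≤-reflexive (sym ∣xs∣≡n)))))
    where
    branch : ∀ {v} z → v ∈ S → ∃ λ w → w ∈ S × Adj G v w × w ≢ z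
    branch {v} z v∈S with any? (λ w → w ∈? S ×-dec adj? G v w ×-dec ¬? (w ≟ z))
    ... | yes found = found
    ... | no ¬found = contradiction
      (v , v∈S , λ x y x∈S y∈S vx vy → trans (≡z x x∈S vx) (sym (≡z y y∈S vy))) ¬leaf
      where
      ≡z : ∀ x → x ∈ S → Adj G v x → x ≡ z
      ≡z x x∈S vx = decidable-stable (x ≟ z) λ x≢z → ¬found (x , x∈S , vx , x≢z)

-- A rooting of the forest: the parent of u is the neighbour of u that is less
-- deep than u.
record Layering (G : Graph n) (N : Pred (Fin n) 0ℓ) (S : Subset n) (m : ℕ) : Set where
  field
    depth         : Fin n → ℕ
    colour        : Fin n → Fin 2
    depth<        : ∀ {v} → v ∈ S → depth v < m
    depth≢        : ∀ {u v} → u ∈ S → v ∈ S → Adj G u v → depth u ≢ depth v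
    parent-unique : ∀ {u v w} → u ∈ S → v ∈ S → w ∈ S → Adj G u v → Adj G u w →
                    depth v < depth u → depth w < depth u → v ≡ w
    forced        : ∀ {v} → v ∈ S → N v → colour v ≡ suc zero
    alternating   : ∀ {u v} → u ∈ S → v ∈ S → ¬ N u → Adj G u v →
                    depth v < depth u → colour u ≢ colour v

opposite≢ : ∀ (c : Fin 2) → opposite c ≢ c
opposite≢ zero       ()
opposite≢ (suc zero) ()

-- Induction on the size of `S`: a leaf `l` is removed, the rest is layered, and `l` is put deeper
-- than everything else, so that its only possible neighbour becomes its parent. Thus `depth`
-- reverses the order of removal and need not be the distance to a root. The colour of `l` is chosen
-- last and disturbs no earlier constraint.
layering : ∀ (G : Graph n) {N} → IsForest G → Decidable N →
           ∀ m (S : Subset n) → ∣ S ∣ ≤ m → Layering G N S m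
layering {n} G {N} forest N? m S ∣S∣≤m with nonempty? S
... | no S≡∅ = record
  { depth         = const 0
  ; colour        = const zero
  ; depth<        = λ v∈S → contradiction (_ , v∈S) S≡∅
  ; depth≢        = λ v∈S → contradiction (_ , v∈S) S≡∅
  ; parent-unique = λ v∈S → contradiction (_ , v∈S) S≡∅
  ; forced        = λ v∈S → contradiction (_ , v∈S) S≡∅
  ; alternating   = λ v∈S → contradiction (_ , v∈S) S≡∅
  }
... | yes S≢∅ with ∃leaf G forest S S≢∅
...   | l , l∈S , leaf with m | ℕ.<-≤-trans (x∈p⇒∣p-x∣<∣p∣ l∈S) ∣S∣≤m
...     | suc m | s≤s ∣S-l∣≤m = record
  { depth         = depth
  ; colour        = colour
  ; depth<        = depth<
  ; depth≢        = depth≢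
  ; parent-unique = parent-unique
  ; forced        = forced
  ; alternating   = alternating
  }
  where
  module L = Layering (layering G {N} forest N? m (S - l) ∣S-l∣≤m)

  keep : ∀ {x} → x ∈ S → x ≢ l → x ∈ S - l
  keep = x∈p∧x≢y⇒x∈p-y

  below : ∀ {x} → x ∈ S → x ≢ l → L.depth x < m
  below x∈S x≢l = L.depth< (keep x∈S x≢l)

  leafColour : ∃ λ c → (N l → c ≡ suc zero) ×
               (¬ N l → ∀ x → x ∈ S → Adj G l x → c ≢ L.colour x)
  leafColour with N? l
  ... | yes Nl = suc zero , (λ _ → refl) , λ ¬Nl → contradiction Nl ¬Nl
  ... | no ¬Nl with any? (λ x → x ∈? S ×-dec adj? G l x)
  ...   | no ¬x = zero , (λ Nl → contradiction Nl ¬Nl) ,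
                  λ _ x x∈S lx → contradiction (x , x∈S , lx) ¬x
  ...   | yes (y , y∈S , ly) = opposite (L.colour y) , (λ Nl → contradiction Nl ¬Nl) ,
                  λ _ x x∈S lx → subst (λ z → opposite (L.colour y) ≢ L.colour z)
                    (leaf y x y∈S x∈S ly lx) (opposite≢ (L.colour y))

  depth : Fin n → ℕ
  depth x = if does (x ≟ l) then m else L.depth x

  colour : Fin n → Fin 2
  colour x = if does (x ≟ l) then proj₁ leafColour else L.colour x

  depth< : ∀ {v} → v ∈ S → depth v < suc m
  depth< {v} v∈S with v ≟ l
  ... | yes _  = ℕ.≤-refl
  ... | no v≢l = ℕ.m<n⇒m<1+n (below v∈S v≢l)

  depth≢ : ∀ {u v} → u ∈ S → v ∈ S → Adj G u v → depth u ≢ depth v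
  depth≢ {u} {v} u∈S v∈S uv with u ≟ l | v ≟ l
  ... | yes refl | yes refl = contradiction uv (adj-irrefl G refl)
  ... | yes refl | no v≢l   = ≢-sym (ℕ.<⇒≢ (below v∈S v≢l))
  ... | no u≢l   | yes refl = ℕ.<⇒≢ (below u∈S u≢l)
  ... | no u≢l   | no v≢l   = L.depth≢ (keep u∈S u≢l) (keep v∈S v≢l) uv

  parent-unique : ∀ {u v w} → u ∈ S → v ∈ S → w ∈ S → Adj G u v → Adj G u w →
                  depth v < depth u → depth w < depth u → v ≡ w
  parent-unique {u} {v} {w} u∈S v∈S w∈S uv uw v<u w<u with u ≟ l | v ≟ l | w ≟ l
  ... | yes refl | _        | _        = leaf v w v∈S w∈S uv uw
  -- The leaf is deeper than all other vertices, so it is the parent of none.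
  ... | no u≢l   | yes refl | _        = contradiction v<u (ℕ.<-asym (below u∈S u≢l))
  ... | no u≢l   | no _     | yes refl = contradiction w<u (ℕ.<-asym (below u∈S u≢l))
  ... | no u≢l   | no v≢l   | no w≢l   =
    L.parent-unique (keep u∈S u≢l) (keep v∈S v≢l) (keep w∈S w≢l) uv uw v<u w<u

  forced : ∀ {v} → v ∈ S → N v → colour v ≡ suc zero
  forced {v} v∈S Nv with v ≟ l
  ... | yes refl = proj₁ (proj₂ leafColour) Nv
  ... | no v≢l   = L.forced (keep v∈S v≢l) Nv

  alternating : ∀ {u v} → u ∈ S → v ∈ S → ¬ N u → Adj G u v →
                depth v < depth u → colour u ≢ colour v
  alternating {u} {v} u∈S v∈S ¬Nu uv v<u with u ≟ l | v ≟ l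
  ... | yes refl | yes refl = contradiction uv (adj-irrefl G refl)
  ... | yes refl | no _     = proj₂ (proj₂ leafColour) ¬Nu v v∈S uv
  ... | no u≢l   | yes refl = contradiction v<u (ℕ.<-asym (below u∈S u≢l))
  ... | no u≢l   | no v≢l   = L.alternating (keep u∈S u≢l) (keep v∈S v≢l) ¬Nu uv v<u

module _ (H : Graph n) (depth : Fin n → ℕ)
         (depth≢ : ∀ {u v} → Adj H u v → depth u ≢ depth v)
         (parent-unique : ∀ {u v w} → Adj H u v → Adj H u w →
                          depth v < depth u → depth w < depth u → v ≡ w) where

  Parent : Rel (Fin n) 0ℓ
  Parent u w = Adj H u w × depth w < depth u

  ∃top : ∀ v → ∃ λ t → Star Parent v t × (∀ w → ¬ Parent t w)
  ∃top v = go v (<-wellFounded (depth v))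
    where
    go : ∀ v → Acc _<_ (depth v) → ∃ λ t → Star Parent v t × (∀ w → ¬ Parent t w)
    go v (acc rec) with any? (λ w → adj? H v w ×-dec depth w ℕ.<? depth v)
    ... | no ¬parent = v , ε , λ w p → ¬parent (w , p)
    ... | yes (w , p) with go w (rec (proj₂ p))
    ...   | t , up , top = t , p ◅ up , top

  -- The chain of parents up to `t` is carried along the walk. A step to a child lengthens the
  -- chain; a step to the parent removes its first edge, because parents are unique.
  ascend : ∀ {t x u} → (∀ w → ¬ Parent t w) → Star Parent x t → Star (Adj H) x u → Star Parent u t
  ascend top up ε = up
  ascend {x = x} top up (_◅_ {j = y} xy path) with ℕ.<-cmp (depth x) (depth y) | up
  ... | B.tri< x<y _ _ | _              = ascend top ((adj-sym H xy , x<y) ◅ up) path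
  ... | B.tri≈ _ x≡y _ | _              = contradiction x≡y (depth≢ xy)
  ... | B.tri> _ _ y<x | ε              = contradiction (xy , y<x) (top y)
  ... | B.tri> _ _ y<x | (xz , z<x) ◅ zt
    with refl ← parent-unique xz xy z<x y<x = ascend top zt path

  -- Each component has a single root `t`, so an argument that uses the parent of a vertex misses
  -- only one vertex per component.
  topOrParent : ∀ v → ∃ λ t → ∀ {u} → Star (Adj H) v u → u ≡ t ⊎ ∃ (Parent u)
  topOrParent v with ∃top v
  ... | t , up , top = t , λ path → first (ascend top up path)
    where
    first : ∀ {u} → Star Parent u t → u ≡ t ⊎ ∃ (Parent u)
    first ε       = inj₁ refl
    first (p ◅ _) = inj₂ (_ , p)

-- Graphs of large girth

cycle⇒girth≤ : ∀ {g} (G : Graph n) → [ g ] ≤⁺ girth G → ∀ vs → IsCycle G vs → g ≤ length vs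
cycle⇒girth≤ G g≤ vs cycle with girth G | girth-isGirth G | g≤
... | _ | _ , min | _≤⁺_.[ g≤h ] = ℕ.≤-trans g≤h (min (length vs) (vs , refl , cycle))
... | _ | forest  | _ _≤⁺_.≤⊤⁺   = contradiction cycle (forest vs)

module _ (G : Graph n) (girth≥7 : ∀ vs → IsCycle G vs → 7 ≤ length vs) where

  private
    short : ∀ vs {_ : True (length vs ℕ.<? 7)} → ¬ IsCycle G vs
    short vs {<7} cycle = ℕ.<⇒≱ (toWitness <7) (girth≥7 vs cycle)

    ≠ : ∀ {u v} → Adj G u v → u ≢ v
    ≠ = adj⇒≢ G

    rev : ∀ {u v} → Adj G u v → Adj G v u
    rev = adj-sym G

  noTriangle : ∀ {u v w} → Adj G u v → Adj G v w → ¬ Adj G w u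
  noTriangle uv vw wu = short (_ ∷ _ ∷ _ ∷ [])
    ( s≤s (s≤s (s≤s z≤n))
    , (≠ uv ∷ ≢-sym (≠ wu) ∷ []) ∷ (≠ vw ∷ []) ∷ [] ∷ []
    , uv ∷ vw ∷ wu ∷ [-] )

  -- Two different midpoints would form a 4-cycle with `a` and `b`.
  path₂-unique : ∀ {a b v w} → a ≢ b →
                 Adj G a v → Adj G v b → Adj G a w → Adj G w b → v ≡ w
  path₂-unique {v = v} {w} a≢b av vb aw wb = decidable-stable (v ≟ w) λ v≢w →
    short (_ ∷ _ ∷ _ ∷ _ ∷ [])
      ( s≤s (s≤s (s≤s z≤n))
      , (≠ av ∷ a≢b ∷ ≠ aw ∷ []) ∷ (≠ vb ∷ v≢w ∷ []) ∷ (≢-sym (≠ wb) ∷ []) ∷ [] ∷ []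
      , av ∷ vb ∷ rev wb ∷ rev aw ∷ [-] )

  -- If the two paths agree in one inner position, the other position is settled by `path₂-unique`.
  -- Otherwise they form a 6-cycle: any further coincidence among its vertices would give a
  -- triangle.
  path₃-unique : ∀ {a b v w x y} → a ≢ x → a ≢ y → b ≢ v → b ≢ w →
                 Adj G a v → Adj G v x → Adj G x b →
                 Adj G a w → Adj G w y → Adj G y b → v ≡ w × x ≡ y
  path₃-unique {a} {b} {v} {w} {x} {y} a≢x a≢y b≢v b≢w av vx xb aw wy yb
    with v ≟ w | x ≟ y
  ... | yes refl | _        = refl , path₂-unique (≢-sym b≢v) vx xb wy yb
  ... | no v≢w   | yes refl = contradiction (path₂-unique a≢x av vx aw wy) v≢w
  ... | no v≢w   | no x≢y   = contradiction
    ( s≤s (s≤s (s≤s z≤n))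
    , (≠ av ∷ a≢x ∷ a≢b ∷ a≢y ∷ ≠ aw ∷ [])
      ∷ (≠ vx ∷ ≢-sym b≢v ∷ v≢y ∷ v≢w ∷ [])
      ∷ (≠ xb ∷ x≢y ∷ x≢w ∷ [])
      ∷ (≢-sym (≠ yb) ∷ b≢w ∷ [])
      ∷ (≢-sym (≠ wy) ∷ [])
      ∷ [] ∷ []
    , av ∷ vx ∷ xb ∷ rev yb ∷ rev wy ∷ rev aw ∷ [-] )
    (short (_ ∷ _ ∷ _ ∷ _ ∷ _ ∷ _ ∷ []))
    where
    a≢b : a ≢ b
    a≢b refl = noTriangle av vx xb
    v≢y : v ≢ y
    v≢y refl = noTriangle vx xb (rev yb)
    x≢w : x ≢ w
    x≢w refl = noTriangle av vx (rev aw)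

-- The colouring

∈colourClass⇒≡ : ∀ (χ : TwoColouring n) {i v} → v ∈ colourClass χ i → χ v ≡ i
∈colourClass⇒≡ χ {i} {v} v∈
  with χ v ≟ i | trans (sym (lookup∘tabulate (λ v → does (χ v ≟ i)) v)) ([]=⇒lookup v∈)
... | yes χv≡i | _  = χv≡i
... | no _     | ()

module _ (G : Graph n) (girth≥7 : ∀ vs → IsCycle G vs → 7 ≤ length vs)
         {A : Subset n} (forest : IsForest (G ─ A)) {k : ℕ} (∣A∣≤k : ∣ A ∣ ≤ k) where

  N : Pred (Fin n) 0ℓ
  N v = ∃ λ a → a ∈ A × Adj G v a

  N? : Decidable N
  N? v = any? λ a → a ∈? A ×-dec adj? G v a

  -- All labels are layered, which turns every membership condition into `∈⊤`. Vertices of `A` and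
  -- labels outside the graph are isolated in `G ─ A`, so they do no harm.
  open Layering (layering (G ─ A) {N} forest N? n ⊤ (∣p∣≤n {n} ⊤))

  χ : TwoColouring n
  χ v = if does (v ∈? A) then zero else colour v

  χ-∈A : ∀ {v} → v ∈ A → χ v ≡ zero
  χ-∈A {v} v∈A with v ∈? A
  ... | yes _  = refl
  ... | no v∉A = contradiction v∈A v∉A

  χ-∉A : ∀ {v} → v ∉ A → χ v ≡ colour v
  χ-∉A {v} v∉A with v ∈? A
  ... | yes v∈A = contradiction v∈A v∉A
  ... | no _    = refl

  -- A neighbour of `A` outside `A` lies in `N`, where the colour 1 is forced, while `A` has colour
  -- 0.
  boundary-bichromatic : ∀ {u v} → u ∈ A → v ∉ A → Adj G u v → χ u ≢ χ v
  boundary-bichromatic u∈A v∉A uv eq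
    with () ← trans (sym (χ-∈A u∈A)) (trans eq
                (trans (χ-∉A v∉A) (forced ∈⊤ (_ , u∈A , adj-sym G uv))))

  module _ (i : Fin 2) where

    private
      H : Graph n
      H = G ⟨ colourClass χ i ⟩

      H─A : Graph n
      H─A = (G ─ A) ⟨ colourClass χ i ⟩

    sameColour : ∀ {u v} → u ∈ colourClass χ i → v ∈ colourClass χ i → χ u ≡ χ v
    sameColour u∈ v∈ = trans (∈colourClass⇒≡ χ u∈) (sym (∈colourClass⇒≡ χ v∈))

    stays-in : ∀ {u v} → u ∈ A → Star (Adj H) u v → v ∈ A
    stays-in u∈A ε = u∈A
    stays-in u∈A (_◅_ {j = w} (uw , u∈ , w∈) path) with w ∈? A
    ... | yes w∈A = stays-in w∈A path
    ... | no w∉A  = contradiction (sameColour u∈ w∈) (boundary-bichromatic u∈A w∉A uw)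

    -- No edge of `H` crosses the boundary of `A`. Hence a component outside `A` lives in the rooted
    -- forest, where `topOrParent` applies.
    stays-out : ∀ {u v} → u ∉ A → Star (Adj H) u v → Star (Adj H─A) u v
    stays-out u∉A ε = ε
    stays-out u∉A (_◅_ {j = w} (uw , u∈ , w∈) path) with w ∈? A
    ... | no w∉A  = ((uw , x∉p⇒x∈∁p u∉A , x∉p⇒x∈∁p w∉A) , u∈ , w∈) ◅ stays-out w∉A path
    ... | yes w∈A = contradiction (sameColour w∈ u∈)
                      (boundary-bichromatic w∈A u∉A (adj-sym G uw))

    -- Each constructor stores the data from which `u` is recovered: for `inner` the path `a`, `u`,
    -- `w`, `b` around the edge from `u` to its parent `w`, for `below` the path `a`, `u`, `t`.
    data Role (t u : Fin n) : Set where
      top   : u ≡ t → Role t u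
      inner : ∀ {w a b} → Adj (G ─ A) u w → depth w < depth u →
              a ∈ A → Adj G u a → b ∈ A → Adj G w b → Role t u
      below : ∀ {a} → Adj (G ─ A) u t → a ∈ A → Adj G u a → Role t u

    -- Outside `N` a vertex differs in colour from its parent, so sharing the colour of the parent
    -- forces membership in `N`.
    childInN : ∀ {u w} → Adj H─A u w → depth w < depth u → N u
    childInN {u} ((uw , u∉A , w∉A) , u∈ , w∈) w<u = decidable-stable (N? u) λ ¬Nu →
      alternating ∈⊤ ∈⊤ ¬Nu (uw , u∉A , w∉A) w<u
        (trans (sym (χ-∉A (x∈∁p⇒x∉p u∉A)))
          (trans (sameColour u∈ w∈) (χ-∉A (x∈∁p⇒x∉p w∉A))))

    role : ∀ v → ∃ λ t → ∀ {u} → Star (Adj H─A) v u → Role t u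
    role v with topOrParent H─A depth
                  (depth≢ ∈⊤ ∈⊤ ∘ proj₁)
                  (λ uv uw → parent-unique ∈⊤ ∈⊤ ∈⊤ (proj₁ uv) (proj₁ uw)) v
    ... | t , split = t , go
      where
      go : ∀ {u} → Star (Adj H─A) v u → Role t u
      go path with split path
      ... | inj₁ u≡t = top u≡t
      ... | inj₂ (w , uw , w<u) with childInN uw w<u | N? w
      ...   | a , a∈A , ua | yes (b , b∈A , wb) = inner (proj₁ uw) w<u a∈A ua b∈A wb
      -- The parent `w` is in the same component. If it had a parent there, `childInN` would put it
      -- in `N`; hence it is the top.
      ...   | a , a∈A , ua | no ¬Nw with split (path ◅◅ uw ◅ ε)
      ...     | inj₁ refl            = below (proj₁ uw) a∈A ua
      ...     | inj₂ (_ , wx , x<w) = contradiction (childInN wx x<w) ¬Nw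

    private
      label : ∀ {a} → a ∈ A → Fin k
      label a∈A = inject≤ (index a∈A) ∣A∣≤k

      label-injective : ∀ {a b} (a∈A : a ∈ A) (b∈A : b ∈ A) → label a∈A ≡ label b∈A → a ≡ b
      label-injective a∈A b∈A eq =
        index-injective a∈A b∈A (inject≤-injective ∣A∣≤k ∣A∣≤k _ _ eq)

      -- A common neighbour of `u` and `w` in `A` would complete a triangle.
      label≢ : ∀ {u w a b} → Adj G u w → (a∈A : a ∈ A) → Adj G u a →
               (b∈A : b ∈ A) → Adj G w b → label a∈A ≢ label b∈A
      label≢ uw a∈A ua b∈A wb eq with refl ← label-injective a∈A b∈A eq =
        noTriangle G girth≥7 uw wb (adj-sym G ua)

      ∈∉⇒≢ : ∀ {a x} → a ∈ A → x ∈ ∁ A → a ≢ x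
      ∈∉⇒≢ a∈A x∈∁A refl = x∈∁p⇒x∉p x∈∁A a∈A

    -- The three summands count the `inner` vertices by unordered pairs from `A`, the `below`
    -- vertices by single elements of `A`, and the top.
    code : ∀ {t u} → Role t u → Fin (pairs k + k + 1)
    code (top _) = (pairs k + k) ↑ʳ zero
    code (inner (uw , _) _ a∈A ua b∈A wb) =
      pairIndex (label a∈A) (label b∈A) (label≢ uw a∈A ua b∈A wb) ↑ˡ k ↑ˡ 1
    code (below _ a∈A _) = (pairs k ↑ʳ label a∈A) ↑ˡ 1

    code-injective : ∀ {t u v} (r : Role t u) (s : Role t v) → code r ≡ code s → u ≡ v
    code-injective (top refl) (top refl) _ = refl
    code-injective (top _) (inner _ _ _ _ _ _) eq = contradiction (sym eq) (↑ˡ≢↑ʳ _ _)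
    code-injective (top _) (below _ _ _) eq = contradiction (sym eq) (↑ˡ≢↑ʳ _ _)
    code-injective (inner _ _ _ _ _ _) (top _) eq = contradiction eq (↑ˡ≢↑ʳ _ _)
    code-injective (below _ _ _) (top _) eq = contradiction eq (↑ˡ≢↑ʳ _ _)
    code-injective (inner _ _ _ _ _ _) (below _ _ _) eq =
      contradiction (↑ˡ-injective 1 _ _ eq) (↑ˡ≢↑ʳ _ _)
    code-injective (below _ _ _) (inner _ _ _ _ _ _) eq =
      contradiction (sym (↑ˡ-injective 1 _ _ eq)) (↑ˡ≢↑ʳ _ _)
    -- Both vertices are midpoints of paths of length 2 from one vertex of `A` to `t`.
    code-injective (below (ut , _ , t∉A) a∈A ua) (below (vt , _) b∈A vb) eq
      with refl ← label-injective a∈A b∈A (↑ʳ-injective (pairs k) _ _ (↑ˡ-injective 1 _ _ eq)) =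
      path₂-unique G girth≥7 (∈∉⇒≢ a∈A t∉A) (adj-sym G ua) ut (adj-sym G vb) vt
    code-injective (inner (uw , u∉A , w∉A) w<u a∈A ua b∈A wb)
                   (inner (vx , v∉A , x∉A) x<v c∈A vc d∈A xd) eq
      with pairIndex-injective _ _ _ _ _ _ (↑ˡ-injective k _ _ (↑ˡ-injective 1 _ _ eq))
    ... | inj₁ (a≡c , b≡d)
      with refl ← label-injective a∈A c∈A a≡c | refl ← label-injective b∈A d∈A b≡d =
      proj₁ (path₃-unique G girth≥7
        (∈∉⇒≢ a∈A w∉A) (∈∉⇒≢ a∈A x∉A) (∈∉⇒≢ b∈A u∉A) (∈∉⇒≢ b∈A v∉A)
        (adj-sym G ua) uw wb (adj-sym G vc) vx xd)
    -- The pair occurs in reverse order, so `path₃-unique` identifies the two edges with their ends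
    -- exchanged. Then `u` and `w` would each be the parent of the other.
    ... | inj₂ (a≡d , b≡c)
      with refl ← label-injective a∈A d∈A a≡d | refl ← label-injective b∈A c∈A b≡c
      with refl , refl ← path₃-unique G girth≥7
        (∈∉⇒≢ a∈A w∉A) (∈∉⇒≢ a∈A v∉A) (∈∉⇒≢ b∈A u∉A) (∈∉⇒≢ b∈A x∉A)
        (adj-sym G ua) uw wb (adj-sym G xd) (adj-sym G vx) vc =
      contradiction w<u (ℕ.<-asym x<v)

  χ-clustering : HasClustering G χ (pairs k + k + 1)
  χ-clustering K (i , v , _ , K⇔) with v ∈? A
  -- A component that meets `A` stays inside it and has at most `k` vertices.
  ... | yes v∈A = ℕ.≤-trans
    (p⊆q⇒∣p∣≤∣q∣ λ {u} u∈K → stays-in i v∈A (Equivalence.to (K⇔ u) u∈K))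
    (ℕ.≤-trans ∣A∣≤k (ℕ.≤-trans (ℕ.m≤n+m k (pairs k)) (ℕ.m≤m+n (pairs k + k) 1)))
  ... | no v∉A with role i v
  ...   | t , roles = injectiveOn⇒∣p∣≤ K (code i ∘ roleOf)
                        (λ u∈K w∈K → code-injective i (roleOf u∈K) (roleOf w∈K))
    where
    roleOf : ∀ {u} → u ∈ K → Role i t u
    roleOf {u} u∈K = roles (stays-out i v∉A (Equivalence.to (K⇔ u) u∈K))

theorem21 : ∀ (k : ℕ) {n : ℕ} (G : Graph n) →
    feedbackVertexNumber G ≤ k →
    [ 7 ] ≤⁺ girth G →
    TwoColourableWithClustering G (k C 2 + k + 1)
theorem21 k G fvn≤k 7≤girth with feedbackVertexNumber-isFeedbackVertexNumber G
... | (A , ∣A∣≡fvn , _ , forest) , _ =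
  χ G girth≥7 forest ∣A∣≤k ,
  subst (λ c → HasClustering G (χ G girth≥7 forest ∣A∣≤k) (c + k + 1)) (pairs≡C2 k)
    (χ-clustering G girth≥7 forest ∣A∣≤k)
  where
  girth≥7 : ∀ vs → IsCycle G vs → 7 ≤ length vs
  girth≥7 = cycle⇒girth≤ G 7≤girth

  ∣A∣≤k : ∣ A ∣ ≤ k
  ∣A∣≤k = ℕ.≤-trans (ℕ.≤-reflexive ∣A∣≡fvn) fvn≤k
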